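{- Let $S$ be a semigroup, let $n\geq 1$ be a natural number and let $\mathcal{F}$ be a family of functions from $S^n$ to $S$ which is transitive and reflexive. Then $W(\beta S,\mathcal{F})\neq\emptyset$, i.e. there exists a weakly maximal ultrafilter in $(\beta S,\leq_{\mathcal{F}})$.
   Context: For $A,B\subseteq S$, $A\leq_{\mathcal{F}}B$ means that for every finite $F\subseteq A$ there is $f\in\mathcal{F}$ with $f(F^{n})=\{f(a_1,\dots,a_n)\mid a_i\in F\}\subseteq B$. The family $\mathcal{F}$ is transitive (resp. reflexive) if the relation $\leq_{\mathcal{F}}$ on the power set of $S$ is transitive (resp. reflexive). For $\mathcal{U},\mathcal{V}\in\beta S$, $\mathcal{U}\leq_{\mathcal{F}}\mathcal{V}$ means that for every $B\in\mathcal{V}$ there is $A\in\mathcal{U}$ with $A\leq_{\mathcal{F}}B$. An ultrafilter $\mathcal{U}\in\beta S$ is weakly maximal if for every $\mathcal{V}\in\beta S$, $\mathcal{U}\leq_{\mathcal{F}}\mathcal{V}$ implies $\mathcal{V}\leq_{\mathcal{F}}\mathcal{U}$; $W(\beta S,\mathcal{F})$ is the set of weakly maximal ultrafilters. -}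

module Defs where

open import Data.List.Base using (List)
open import Data.List.Membership.Propositional using () renaming (_∈_ to _∈ˡ_)
open import Data.List.Relation.Unary.All using () renaming (All to Allˡ)
open import Data.Nat.Base using (ℕ)
open import Data.Product.Base using (∃; _×_)
open import Data.Sum.Base using (_⊎_)
open import Data.Vec.Base using (Vec)
open import Data.Vec.Relation.Unary.All using () renaming (All to Allᵛ)
open import Level using (Level; suc)
open import Relation.Binary.Definitions using (Reflexive; Transitive)
open import Relation.Unary using (Pred; _∈_; _∉_; _⊆_; _∩_; ∁; Empty; Universal)

private
  variable
    ℓ : Level
    n : ℕ

-- The power set of S : Set ℓ is Pred S ℓ.  Upward closure makes membership
-- in an ultrafilter invariant under extensional equality of predicates.
record Ultrafilter (S : Set ℓ) : Set (suc ℓ) where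
  field
    sets       : Pred (Pred S ℓ) ℓ
    universal  : ∀ {A} → Universal A → A ∈ sets
    proper     : ∀ {A} → Empty A → A ∉ sets
    upward     : ∀ {A B} → A ⊆ B → A ∈ sets → B ∈ sets
    intersect  : ∀ {A B} → A ∈ sets → B ∈ sets → A ∩ B ∈ sets
    ultra      : ∀ A → A ∈ sets ⊎ ∁ A ∈ sets

open Ultrafilter public using (sets)

Family : Set ℓ → ℕ → Set (suc ℓ)
Family {ℓ} S n = Pred (Vec S n → S) ℓ

-- A finite set F ⊆ A is given by a list of its elements (order and
-- repetitions are irrelevant), and Fⁿ by the vectors with entries in F.
_≤[_]_ : {S : Set ℓ} → Pred S ℓ → Family S n → Pred S ℓ → Set ℓ
A ≤[ 𝓕 ] B = ∀ F → Allˡ (_∈ A) F →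
  ∃ λ f → f ∈ 𝓕 × (∀ v → Allᵛ (_∈ˡ F) v → f v ∈ B)

TransitiveFamily : {S : Set ℓ} → Family S n → Set (suc ℓ)
TransitiveFamily {ℓ} {S = S} 𝓕 = Transitive {A = Pred S ℓ} (_≤[ 𝓕 ]_)

ReflexiveFamily : {S : Set ℓ} → Family S n → Set (suc ℓ)
ReflexiveFamily {ℓ} {S = S} 𝓕 = Reflexive {A = Pred S ℓ} (_≤[ 𝓕 ]_)

_≤β[_]_ : {S : Set ℓ} → Ultrafilter S → Family S n → Ultrafilter S → Set (suc ℓ)
U ≤β[ 𝓕 ] V = ∀ B → B ∈ sets V → ∃ λ A → A ∈ sets U × A ≤[ 𝓕 ] B

-- Weakly maximal ultrafilters.
W : {S : Set ℓ} → Family S n → Pred (Ultrafilter S) (suc ℓ)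
W 𝓕 U = ∀ V → U ≤β[ 𝓕 ] V → V ≤β[ 𝓕 ] U

{-# OPTIONS --safe #-}

-- By transitivity, U is weakly maximal iff the upward ≤[ 𝓕 ]-closure of U is
-- minimal among the upward closures of ultrafilters.  Passing to complements,
-- one looks for a maximal family 𝓖 of sets such that S has no finite cover by
-- sets lying ≤[ 𝓕 ]-below members of 𝓖.  This is a condition of finite
-- character, so 𝓖 exists by Tukey's lemma, and any ultrafilter U disjoint from
-- 𝓖 is weakly maximal: if U ≤ V and B ∈ U had no A ∈ V below it, then nothing
-- below 𝓖 ∪ { B } would be in V, and B could be added to 𝓖.
module Submission where

open import Defs
open import Algebra.Core using (Op₂)
open import Algebra.Structures using (IsSemigroup)
open import Axiom.ExcludedMiddle using (ExcludedMiddle)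
open import Axiom.Extensionality.Propositional using (Extensionality)
open import Data.Bool.Base using (Bool; T)
open import Data.Bool.Properties using (T-≡; ⇔→≡)
open import Data.Empty using (⊥-elim)
open import Data.List.Base using (List; []; _∷_; _++_)
open import Data.List.Relation.Binary.Pointwise.Base using (Pointwise; []; _∷_)
open import Data.List.Relation.Unary.All as All using (All; []; _∷_)
open import Data.List.Relation.Unary.All.Properties using (++⁺)
open import Data.List.Relation.Unary.Any using (Any; here; there)
open import Data.List.Relation.Unary.Any.Properties using (++⁺ˡ; ++⁺ʳ)
open import Data.Nat.Base using (ℕ; _≥_)
open import Data.Product.Base using (∃; _×_; _,_)
open import Data.Sum.Base using (_⊎_; inj₁; inj₂; [_,_]′; swap)
open import Data.Unit.Polymorphic.Base using (⊤)
open import Function.Base using (_∘_; id)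
open import Function.Bundles using (mk⇔; Equivalence)
open import Level using (Level; 0ℓ; lift; lower) renaming (suc to lsuc)
open import Relation.Binary.PropositionalEquality using (_≡_; refl)
open import Relation.Nullary.Decidable using (Dec; yes; no; ⌊_⌋; toWitness; fromWitness; decidable-stable)
open import Relation.Nullary.Negation using (¬_; contradiction)
open import Relation.Unary using (Pred; Satisfiable; Universal; ∅; _∈_; _∉_; _⊆_; _∩_; _∪_; ∁; ｛_｝)

private
  variable
    a b c p ℓ : Level
    X : Set a
    n : ℕ

-- Properties of finite character.

Finitely : Pred (List X) p → Pred X b → Set _
Finitely P A = ∀ xs → All (_∈ A) xs → P xs

Finitely-antimono : {P : Pred (List X) p} {A : Pred X b} {B : Pred X c} →
  A ⊆ B → Finitely P B → Finitely P A
Finitely-antimono A⊆B finB xs = finB xs ∘ All.map A⊆B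

-- Testing one-point extensions suffices, since `Finitely P` passes to subsets.
MaximalFinitely : Pred (List X) p → Pred X b → Set _
MaximalFinitely P M = ∀ x → Finitely P (M ∪ ｛ x ｝) → x ∈ M

maximal-absorbs : {P : Pred (List X) p} {M : Pred X b} {N : Pred X c} →
  MaximalFinitely P M → M ⊆ N → Finitely P N → N ⊆ M
maximal-absorbs {P = P} max M⊆N finN {x} x∈N =
  max x (Finitely-antimono {P = P} [ M⊆N , (λ { refl → x∈N }) ]′ finN)

⋃ˡ : {S : Set ℓ} → List (Pred S ℓ) → Pred S (lsuc ℓ)
⋃ˡ As s = Any (s ∈_) As

-- `Finitely NonCover 𝓘` says that `𝓘` generates a proper ideal of sets.
NonCover : {S : Set ℓ} → Pred (List (Pred S ℓ)) (lsuc ℓ)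
NonCover As = ¬ Universal (⋃ˡ As)

module Classical (em : ∀ a → ExcludedMiddle a) (ext : ∀ a b → Extensionality a b) where

  -- em decides types rather than propositions, so it is also a choice operator.
  choose : (A : Set a) → Dec A
  choose {a} A = em a

  by-contradiction : {A : Set a} → ¬ ¬ A → A
  by-contradiction {A = A} = decidable-stable (choose A)

  -- Zorn's tower argument. Boolean-valued subsets are extensional, and the
  -- subsets of X → Bool do not raise the universe level, so that the union of
  -- the whole tower is again a member of it.
  module Tower {X : Set a} (P : Pred (List X) p) (Base : Pred X b) where

    Sub : Set a
    Sub = X → Bool

    ⟦_⟧ : Sub → Pred X 0ℓ
    ⟦ A ⟧ x = T (A x)

    _≤_ : Sub → Sub → Set a
    A ≤ B = ⟦ A ⟧ ⊆ ⟦ B ⟧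

    char : {Y : Set c} {q : Level} → Pred Y q → Y → Bool
    char Q y = ⌊ choose (Q y) ⌋

    char⁺ : {Y : Set c} {q : Level} (Q : Pred Y q) → Q ⊆ T ∘ char Q
    char⁺ Q {y} = fromWitness {a? = choose (Q y)}

    char⁻ : {Y : Set c} {q : Level} (Q : Pred Y q) → T ∘ char Q ⊆ Q
    char⁻ Q {y} = toWitness {a? = choose (Q y)}

    -- `next` chooses a point for the function `A` itself, so comparing `next A` with `next B` needs
    -- an equality, not just mutual inclusion.
    ≤-antisym : ∀ {A B} → A ≤ B → B ≤ A → A ≡ B
    ≤-antisym A≤B B≤A = ext a 0ℓ λ x → ⇔→≡ (mk⇔
      (λ e → to T-≡ (A≤B (from T-≡ e)))
      (λ e → to T-≡ (B≤A (from T-≡ e))))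
      where open Equivalence

    Addable : Sub → Pred X _
    Addable A x = x ∉ ⟦ A ⟧ × Finitely P (⟦ A ⟧ ∪ ｛ x ｝)

    nextBy : ∀ A → Dec (∃ (Addable A)) → Sub
    nextBy A (yes (x , _)) = char (⟦ A ⟧ ∪ ｛ x ｝)
    nextBy A (no _)        = A

    next : Sub → Sub
    next A = nextBy A (choose _)

    ⋃ : (Sub → Bool) → Pred X a
    ⋃ C x = ∃ λ A → T (C A) × x ∈ ⟦ A ⟧

    -- Joining `Base` makes the empty supremum the bottom of the tower, so `Stage` has no
    -- constructor for it.
    sup : (Sub → Bool) → Sub
    sup C = char (Base ∪ ⋃ C)

    data Stage : Sub → Set a where
      step  : ∀ {A} → Stage A → Stage (next A)
      limit : ∀ C → (∀ A → T (C A) → Stage A) → Stage (sup C)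

    next-inflationary : ∀ A → A ≤ next A
    next-inflationary A with choose (∃ (Addable A))
    ... | yes (x , _) = char⁺ (⟦ A ⟧ ∪ ｛ x ｝) ∘ inj₁
    ... | no _        = id

    next-finitely : ∀ A → Finitely P ⟦ A ⟧ → Finitely P ⟦ next A ⟧
    next-finitely A finA with choose (∃ (Addable A))
    ... | yes (x , _ , fin) =
      Finitely-antimono {P = P} (char⁻ (⟦ A ⟧ ∪ ｛ x ｝)) fin
    ... | no _              = finA

    next-fixed⇒maximal : ∀ A → next A ≤ A → MaximalFinitely P ⟦ A ⟧
    next-fixed⇒maximal A fixed x fin with choose (∃ (Addable A))
    ... | yes (y , y∉A , _) =
      contradiction (fixed (char⁺ (⟦ A ⟧ ∪ ｛ y ｝) (inj₂ refl))) y∉A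
    ... | no ¬addable       = by-contradiction λ x∉A → ¬addable (x , x∉A , fin)

    base-≤-sup : ∀ C → Base ⊆ ⟦ sup C ⟧
    base-≤-sup C = char⁺ (Base ∪ ⋃ C) ∘ inj₁

    sup-upper : ∀ {C A} → T (C A) → A ≤ sup C
    sup-upper {C} A∈C x∈A = char⁺ (Base ∪ ⋃ C) (inj₂ (_ , A∈C , x∈A))

    sup-least : ∀ {C B} → Base ⊆ ⟦ B ⟧ → (∀ A → T (C A) → A ≤ B) → sup C ≤ B
    sup-least {C} base≤B C≤B x∈sup with char⁻ (Base ∪ ⋃ C) x∈sup
    ... | inj₁ x∈base          = base≤B x∈base
    ... | inj₂ (A , A∈C , x∈A) = C≤B A A∈C x∈A

    -- Linearity of the tower.

    base-≤-stage : ∀ {A} → Stage A → Base ⊆ ⟦ A ⟧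
    base-≤-stage (step {A} sA) = next-inflationary A ∘ base-≤-stage sA
    base-≤-stage (limit C _)   = base-≤-sup C

    Extreme : Sub → Set a
    Extreme B = ∀ {A} → Stage A → A ≤ B → ¬ B ≤ A → next A ≤ B

    -- Induction on `A`: a step cannot jump past `B` because `B` is extreme, and a supremum of
    -- stages below `B` stays below `B`.
    extreme-compare : ∀ {A B} → Stage B → Extreme B → Stage A → A ≤ B ⊎ next B ≤ A
    extreme-compare {B = B} sB eB (step {A} sA) with extreme-compare sB eB sA
    ... | inj₂ nB≤A = inj₂ (next-inflationary A ∘ nB≤A)
    ... | inj₁ A≤B with choose (B ≤ A)
    ...   | no B≰A  = inj₁ (eB sA A≤B B≰A)
    ...   | yes B≤A with refl ← ≤-antisym {A} {B} A≤B B≤A = inj₂ id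
    extreme-compare {B = B} sB eB (limit C C⊆Stage)
      with choose (∃ λ A → T (C A) × next B ≤ A)
    ... | yes (A , A∈C , nB≤A) = inj₂ (sup-upper {C} A∈C ∘ nB≤A)
    ... | no none = inj₁ (sup-least {C} {B} (base-≤-stage sB) below)
      where
      below : ∀ A → T (C A) → A ≤ B
      below A A∈C with extreme-compare sB eB (C⊆Stage A A∈C)
      ... | inj₁ A≤B  = A≤B
      ... | inj₂ nB≤A = ⊥-elim (none (A , A∈C , nB≤A))

    extreme : ∀ {B} → Stage B → Extreme B
    extreme (step {B} sB) {A} sA A≤nB nB≰A with extreme-compare sB (extreme sB) sA
    ... | inj₂ nB≤A = ⊥-elim (nB≰A nB≤A)
    ... | inj₁ A≤B with choose (B ≤ A)
    ...   | no B≰A  = next-inflationary B ∘ extreme sB sA A≤B B≰A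
    ...   | yes B≤A with refl ← ≤-antisym {A} {B} A≤B B≤A = id
    extreme (limit C C⊆Stage) {A} sA A≤sup sup≰A
      with choose (∃ λ B → T (C B) × A ≤ B)
    ... | no none = ⊥-elim (sup≰A (sup-least {C} {A} (base-≤-stage sA) below))
      where
      below : ∀ B → T (C B) → B ≤ A
      below B B∈C with extreme-compare (C⊆Stage B B∈C) (extreme (C⊆Stage B B∈C)) sA
      ... | inj₁ A≤B  = ⊥-elim (none (B , B∈C , A≤B))
      ... | inj₂ nB≤A = nB≤A ∘ next-inflationary B
    ... | yes (B , B∈C , A≤B) with choose (B ≤ A)
    ...   | no B≰A  = sup-upper {C} B∈C ∘ extreme (C⊆Stage B B∈C) sA A≤B B≰A
    -- Here `A` is the member `B` of `C`, about which its own extremality is silent; comparing it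
    -- with the whole limit leaves only `next A ≤ sup C`.
    ...   | yes B≤A with refl ← ≤-antisym {A} {B} A≤B B≤A
        with extreme-compare sA (extreme (C⊆Stage B B∈C)) (limit C C⊆Stage)
    ...     | inj₁ sup≤A = ⊥-elim (sup≰A sup≤A)
    ...     | inj₂ nA≤sup = nA≤sup

    stage-linear : ∀ {A B} → Stage A → Stage B → A ≤ B ⊎ B ≤ A
    stage-linear {B = B} sA sB with extreme-compare sB (extreme sB) sA
    ... | inj₁ A≤B  = inj₁ A≤B
    ... | inj₂ nB≤A = inj₂ (nB≤A ∘ next-inflationary B)

    -- By linearity one member of `C` absorbs those that supply the entries; the `Base` alternative
    -- is there for an empty `C`.
    limit-list : ∀ C → (∀ A → T (C A) → Stage A) → ∀ xs → All (_∈ ⟦ sup C ⟧) xs →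
      All (_∈ Base) xs ⊎ ∃ λ A → T (C A) × All (_∈ ⟦ A ⟧) xs
    limit-list C C⊆Stage [] [] = inj₁ []
    limit-list C C⊆Stage (x ∷ xs) (x∈ ∷ xs∈) with char⁻ (Base ∪ ⋃ C) x∈ | limit-list C C⊆Stage xs xs∈
    ... | inj₁ x∈base | inj₁ xs∈base = inj₁ (x∈base ∷ xs∈base)
    ... | inj₁ x∈base | inj₂ (A , A∈C , xs∈A) =
      inj₂ (A , A∈C , base-≤-stage (C⊆Stage A A∈C) x∈base ∷ xs∈A)
    ... | inj₂ (A , A∈C , x∈A) | inj₁ xs∈base =
      inj₂ (A , A∈C , x∈A ∷ All.map (base-≤-stage (C⊆Stage A A∈C)) xs∈base)
    ... | inj₂ (A , A∈C , x∈A) | inj₂ (B , B∈C , xs∈B)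
      with stage-linear (C⊆Stage A A∈C) (C⊆Stage B B∈C)
    ...   | inj₁ A≤B = inj₂ (B , B∈C , A≤B x∈A ∷ xs∈B)
    ...   | inj₂ B≤A = inj₂ (A , A∈C , x∈A ∷ All.map B≤A xs∈B)

    stage-finitely : Finitely P Base → ∀ {A} → Stage A → Finitely P ⟦ A ⟧
    stage-finitely finBase (step {A} sA) = next-finitely A (stage-finitely finBase sA)
    stage-finitely finBase (limit C C⊆Stage) xs xs∈ with limit-list C C⊆Stage xs xs∈
    ... | inj₁ xs∈base = finBase xs xs∈base
    ... | inj₂ (A , A∈C , xs∈A) = stage-finitely finBase (C⊆Stage A A∈C) xs xs∈A

    top : Sub
    top = sup (char Stage)

    top-stage : Stage top
    top-stage = limit (char Stage) (λ _ → char⁻ Stage)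

    -- `next top` is again a stage, hence one of the sets joined in `top`.
    next-top≤top : next top ≤ top
    next-top≤top = sup-upper {char Stage} (char⁺ Stage (step top-stage))

  tukey : (P : Pred (List X) p) {B : Pred X b} → Finitely P B →
    ∃ λ (M : Pred X 0ℓ) → B ⊆ M × Finitely P M × MaximalFinitely P M
  tukey P {B} finB =
    ⟦ top ⟧ , base-≤-sup (char Stage) , stage-finitely finB top-stage ,
    next-fixed⇒maximal top next-top≤top
    where open Tower P B

  -- Maximal ideals and their dual ultrafilters.

  module PrimeIdeal {S : Set ℓ} {𝓘 : Pred (Pred S ℓ) 0ℓ}
    (noncover : Finitely NonCover 𝓘) (maximal : MaximalFinitely NonCover 𝓘) where

    Spanned : Pred (Pred S ℓ) (lsuc ℓ)
    Spanned A = ∃ λ Is → All (_∈ 𝓘) Is × A ⊆ ⋃ˡ Is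

    spanned-list : ∀ As → All Spanned As → ∃ λ Is → All (_∈ 𝓘) Is × ⋃ˡ As ⊆ ⋃ˡ Is
    spanned-list [] [] = [] , [] , λ ()
    spanned-list (A ∷ As) ((Is , Is∈ , A⊆) ∷ rest) with spanned-list As rest
    ... | Js , Js∈ , As⊆ = Is ++ Js , ++⁺ Is∈ Js∈ ,
      λ { (here s∈A) → ++⁺ˡ (A⊆ s∈A) ; (there s∈As) → ++⁺ʳ Is (As⊆ s∈As) }

    spanned-noncover : Finitely NonCover Spanned
    spanned-noncover As As∈ cover with spanned-list As As∈
    ... | Is , Is∈ , As⊆ = noncover Is Is∈ (λ s → As⊆ (cover s))

    𝓘⊆spanned : 𝓘 ⊆ Spanned
    𝓘⊆spanned {A} A∈𝓘 = A ∷ [] , A∈𝓘 ∷ [] , here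

    -- The generated ideal is still proper, so by maximality `𝓘` is that ideal.
    spanned⊆𝓘 : Spanned ⊆ 𝓘
    spanned⊆𝓘 = maximal-absorbs {P = NonCover} maximal 𝓘⊆spanned spanned-noncover

    spanned-off : ∀ {A} Bs → All (_∈ 𝓘 ∪ ｛ A ｝) Bs →
      ∃ λ Is → All (_∈ 𝓘) Is × ∁ A ∩ ⋃ˡ Bs ⊆ ⋃ˡ Is
    spanned-off [] [] = [] , [] , λ ()
    spanned-off (B ∷ Bs) (B∈ ∷ Bs∈) with spanned-off Bs Bs∈ | B∈
    ... | Is , Is∈ , ⊆Is | inj₁ B∈𝓘 = B ∷ Is , B∈𝓘 ∷ Is∈ ,
      λ { (s∉A , here s∈B) → here s∈B ; (s∉A , there s∈Bs) → there (⊆Is (s∉A , s∈Bs)) }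
    ... | Is , Is∈ , ⊆Is | inj₂ refl = Is , Is∈ ,
      λ { (s∉A , here s∈A) → contradiction s∈A s∉A ; (s∉A , there s∈Bs) → ⊆Is (s∉A , s∈Bs) }

    prime : ∀ A → A ∈ 𝓘 ⊎ ∁ A ∈ 𝓘
    prime A with choose (∁ A ∈ 𝓘)
    ... | yes ∁A∈𝓘 = inj₂ ∁A∈𝓘
    -- Dropping `A` from a cover by members of `𝓘` and `A` leaves a cover of `∁ A`, which would put
    -- `∁ A` into the ideal.
    ... | no ∁A∉𝓘 = inj₁ (maximal A λ Bs Bs∈ cover →
      let Is , Is∈ , ⊆Is = spanned-off Bs Bs∈
      in ∁A∉𝓘 (spanned⊆𝓘 (Is , Is∈ , λ {s} s∉A → ⊆Is (s∉A , cover s))))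

    not-both : ∀ {A} → A ∈ 𝓘 → ∁ A ∉ 𝓘
    not-both {A} A∈𝓘 ∁A∈𝓘 = noncover (A ∷ ∁ A ∷ []) (A∈𝓘 ∷ ∁A∈𝓘 ∷ []) cover
      where
      cover : Universal (⋃ˡ (A ∷ ∁ A ∷ []))
      cover s with choose (s ∈ A)
      ... | yes s∈A = here s∈A
      ... | no s∉A  = there (here s∉A)

    dual : Ultrafilter S
    dual = record
      { sets      = λ A → Level.Lift ℓ (∁ A ∈ 𝓘)
      ; universal = λ A-univ → lift (spanned⊆𝓘 ([] , [] , λ {s} s∉A → contradiction (A-univ s) s∉A))
      ; proper    = λ {A} A-empty ∁A∈ → noncover (∁ A ∷ []) (lower ∁A∈ ∷ []) (here ∘ A-empty)
      ; upward    = λ {A} A⊆B ∁A∈ → lift (spanned⊆𝓘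
          (∁ A ∷ [] , lower ∁A∈ ∷ [] , λ s∉B → here (s∉B ∘ A⊆B)))
      ; intersect = λ {A} {B} ∁A∈ ∁B∈ → lift (spanned⊆𝓘
          (∁ A ∷ ∁ B ∷ [] , lower ∁A∈ ∷ lower ∁B∈ ∷ [] , ∁-∩))
      -- Primality is used at `∁ A`, because `∁ A` is in the dual when `∁ (∁ A) ∈ 𝓘`.
      ; ultra     = λ A → [ inj₂ ∘ lift , inj₁ ∘ lift ]′ (swap (prime (∁ A)))
      }
      where
      ∁-∩ : ∀ {A B} → ∁ (A ∩ B) ⊆ ⋃ˡ (∁ A ∷ ∁ B ∷ [])
      ∁-∩ {A} {x = s} s∉A∩B with choose (s ∈ A)
      ... | no s∉A  = here s∉A
      ... | yes s∈A = there (here (λ s∈B → s∉A∩B (s∈A , s∈B)))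

  ultrafilter-avoiding : {S : Set ℓ} {𝓖 : Pred (Pred S ℓ) b} → Finitely NonCover 𝓖 →
    ∃ λ (U : Ultrafilter S) → ∀ {A} → A ∈ 𝓖 → A ∉ sets U
  ultrafilter-avoiding noncover with tukey NonCover noncover
  ... | 𝓘 , 𝓖⊆𝓘 , noncover𝓘 , maximal =
    dual , λ A∈𝓖 ∁A∈𝓘 → not-both (𝓖⊆𝓘 A∈𝓖) (lower ∁A∈𝓘)
    where open PrimeIdeal noncover𝓘 maximal

-- The complements of finitely many non-members meet in a member of `V`, which is nonempty.
noncover-outside : {S : Set ℓ} (V : Ultrafilter S) → Finitely NonCover (∁ (sets V))
noncover-outside V As As∉V cover with disjoint As As∉V
  where
  open Ultrafilter V hiding (sets)
  disjoint : ∀ As → All (_∉ sets V) As → ∃ λ C → C ∈ sets V × C ⊆ ∁ (⋃ˡ As)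
  disjoint [] [] = (λ _ → ⊤) , universal (λ _ → _) , λ _ ()
  disjoint (A ∷ As) (A∉V ∷ As∉V) with ultra A | disjoint As As∉V
  ... | inj₁ A∈V  | _ = contradiction A∈V A∉V
  ... | inj₂ ∁A∈V | C , C∈V , C⊆∁As = ∁ A ∩ C , intersect ∁A∈V C∈V ,
    λ { (s∉A , s∈C) (here s∈A) → s∉A s∈A ; (s∉A , s∈C) (there s∈As) → C⊆∁As s∈C s∈As }
... | C , C∈V , C⊆∁As = Ultrafilter.proper V (λ s s∈C → C⊆∁As s∈C (cover s)) C∈V

-- Families closed downward under `≤[ 𝓕 ]` and weak maximality.

module _ {S : Set ℓ} (𝓕 : Family S n)
  (trans𝓕 : TransitiveFamily 𝓕) (refl𝓕 : ReflexiveFamily 𝓕) where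

  Below : Pred (Pred S ℓ) b → Pred (Pred S ℓ) _
  Below 𝓖 A = ∃ λ G → G ∈ 𝓖 × A ≤[ 𝓕 ] G

  -- Turns the condition on `Below 𝓖` into one on finite lists from `𝓖`, as Tukey's lemma requires.
  -- Repeating an entry of `Gs` allows several sets below it.
  NonCoverBelow : Pred (List (Pred S ℓ)) (lsuc ℓ)
  NonCoverBelow Gs = ∀ As → Pointwise (_≤[ 𝓕 ]_) As Gs → NonCover As

  noncover-below⁺ : {𝓖 : Pred (Pred S ℓ) b} →
    Finitely NonCover (Below 𝓖) → Finitely NonCoverBelow 𝓖
  noncover-below⁺ {𝓖 = 𝓖} fin Gs Gs∈ As As≤Gs = fin As (below As≤Gs Gs∈)
    where
    below : ∀ {As Gs} → Pointwise (_≤[ 𝓕 ]_) As Gs → All (_∈ 𝓖) Gs → All (Below 𝓖) As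
    below [] [] = []
    below (A≤G ∷ As≤Gs) (G∈ ∷ Gs∈) = (_ , G∈ , A≤G) ∷ below As≤Gs Gs∈

  noncover-below⁻ : {𝓖 : Pred (Pred S ℓ) b} →
    Finitely NonCoverBelow 𝓖 → Finitely NonCover (Below 𝓖)
  noncover-below⁻ {𝓖 = 𝓖} fin As As∈ with above As As∈
    where
    above : ∀ As → All (Below 𝓖) As → ∃ λ Gs → All (_∈ 𝓖) Gs × Pointwise (_≤[ 𝓕 ]_) As Gs
    above [] [] = [] , [] , []
    above (A ∷ As) ((G , G∈ , A≤G) ∷ As∈) with above As As∈
    ... | Gs , Gs∈ , As≤Gs = G ∷ Gs , G∈ ∷ Gs∈ , A≤G ∷ As≤Gs
  ... | Gs , Gs∈ , As≤Gs = fin Gs Gs∈ As As≤Gs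

  below-idempotent : {𝓖 : Pred (Pred S ℓ) b} → Below (Below 𝓖) ⊆ Below 𝓖
  below-idempotent {x = A} (B , (G , G∈ , B≤G) , A≤B) = G , G∈ , trans𝓕 {A} {B} {G} A≤B B≤G

  below-extensive : {𝓖 : Pred (Pred S ℓ) b} → 𝓖 ⊆ Below 𝓖
  below-extensive {x = G} G∈ = G , G∈ , refl𝓕 {G}

  -- By transitivity, replacing `𝓖` by `Below 𝓖` puts no new sets below it, so maximality absorbs
  -- `Below 𝓖`.
  maximal-below-closed : {𝓖 : Pred (Pred S ℓ) b} → Finitely NonCoverBelow 𝓖 →
    MaximalFinitely NonCoverBelow 𝓖 → Below 𝓖 ⊆ 𝓖
  maximal-below-closed fin maximal =
    maximal-absorbs {P = NonCoverBelow} maximal below-extensive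
      (noncover-below⁺ (Finitely-antimono {P = NonCover} below-idempotent (noncover-below⁻ fin)))

  module _ (em : ∀ a → ExcludedMiddle a) (ext : ∀ a b → Extensionality a b) where

    open Classical em ext

    weakly-maximal : {𝓖 : Pred (Pred S ℓ) b} → Finitely NonCoverBelow 𝓖 →
      MaximalFinitely NonCoverBelow 𝓖 →
      (U : Ultrafilter S) → (∀ {A} → A ∈ 𝓖 → A ∉ sets U) → U ∈ W 𝓕
    weakly-maximal {𝓖 = 𝓖} fin maximal U U-avoids V U≤V B B∈U =
      by-contradiction λ none →
        U-avoids (maximal B (noncover-below⁺
          (Finitely-antimono {P = NonCover} (below∉V none) (noncover-outside V)))) B∈U
      where
      below∉V : ¬ (∃ λ A → A ∈ sets V × A ≤[ 𝓕 ] B) → Below (𝓖 ∪ ｛ B ｝) ⊆ ∁ (sets V)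
      below∉V none {A} (.B , inj₂ refl , A≤B) A∈V = none (A , A∈V , A≤B)
      -- `U ≤β[ 𝓕 ] V` gives a member of `U` below `A`, hence below `G`, and so in the downward
      -- closed `𝓖`.
      below∉V none {A} (G , inj₁ G∈𝓖 , A≤G) A∈V with U≤V A A∈V
      ... | A′ , A′∈U , A′≤A =
        U-avoids (maximal-below-closed fin maximal (G , G∈𝓖 , trans𝓕 {A′} {A} {G} A′≤A A≤G)) A′∈U

    W-satisfiable : S → Satisfiable (W 𝓕)
    W-satisfiable s with tukey NonCoverBelow {B = ∅}
      -- Only the empty list has to be checked, and the point `s` keeps it from covering `S`.
      (λ { [] [] [] [] cover → contradiction (cover s) λ () })
    ... | 𝓖 , _ , fin , maximal
      with ultrafilter-avoiding (Finitely-antimono {P = NonCover} below-extensive (noncover-below⁻ fin))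
    ...   | U , U-avoids = U , weakly-maximal fin maximal U U-avoids

corollary3p10 : (∀ a → ExcludedMiddle a) →
    (∀ a b → Extensionality a b) →
    ∀ {ℓ : Level} (S : Set ℓ) (_∙_ : Op₂ S) →
    IsSemigroup _≡_ _∙_ →
    S →
    (n : ℕ) → n ≥ 1 →
    (𝓕 : Family S n) →
    TransitiveFamily 𝓕 →
    ReflexiveFamily 𝓕 →
    Satisfiable (W 𝓕)
corollary3p10 em ext S _∙_ _ s n _ 𝓕 trans𝓕 refl𝓕 =
  W-satisfiable 𝓕 (λ {A} {B} {C} → trans𝓕 {A} {B} {C}) (λ {A} → refl𝓕 {A}) em ext s
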